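{- Let $\mathbb K$ be a field of characteristic $p>2$, $\Lambda_1,\dots,\Lambda_n\in\mathbb F_p^\times\subset\mathbb K$, $a\in\mathbb K\setminus\mathbb F_p$, and let $x^0\in\mathbb K^n$ be such that all $2np$ linear polynomials $s-x_i^0+\Lambda_i+aj$, $s-x_i^0+aj$ ($i=1,\dots,n$, $j=0,\dots,p-1$) in $s$ are pairwise distinct. Let $s_i(\varepsilon)\in\mathbb K[[\varepsilon]]$, $i=1,\dots,n$, be the formal branches defined in the context, and $\Phi(s,x)=\varepsilon^{ -1}\prod_{l=1}^n\frac{s-x_l+\Lambda_l}{s-x_l+a}$. Then for $i=1,\dots,n$ and $d=1,\dots,p-1$, $$\prod_{j=0}^{d-1}\Phi(s_i(\varepsilon)+aj,x^0)=\mathcal O(\varepsilon^{p-d}).$$ In particular, this product is $\mathcal O(\varepsilon)$.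
   Context: $\mathbb F_p$ is the prime subfield of $\mathbb K$, $n\ge1$. For $i=1,\dots,n$ put $y_i^0=x_i^0-\Lambda_i$; $s_i(\varepsilon)\in\mathbb K[[\varepsilon]]$ is the unique formal power series with $s_i(0)=y_i^0$ satisfying $$\prod_{l=1}^n\prod_{j=0}^{p-1}(s-x_l^0+\Lambda_l+aj)=\varepsilon^p\prod_{l=1}^n\prod_{j=0}^{p-1}(s-x_l^0+aj)$$ at $s=s_i(\varepsilon)$. ($\varepsilon=\kappa^{ -1}$ where $\kappa$ is the twist parameter of the qKZ connection.) For $N\ge 0$, an element of $\mathbb K((\varepsilon))$ is $\mathcal O(\varepsilon^N)$ if it lies in $\varepsilon^N\mathbb K[[\varepsilon]]$. -}

module Defs where

open import Algebra.Bundles using (CommutativeRing; RawRing; Semiring)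
import Algebra.Definitions
import Algebra.Definitions.RawSemiring
open import Data.Fin.Base using (Fin; toℕ)
open import Data.Nat.Base as ℕ using (ℕ; zero; suc; _∸_)
open import Data.Nat.Divisibility using (_∣_)
open import Data.Product.Base using (∃; _×_; _,_; proj₁)
open import Data.Sum.Base using (_⊎_; inj₁; inj₂)
open import Data.Vec.Functional using (Vector; []; _∷_)
import Data.Vec.Functional.Relation.Binary.Equality.Setoid as VectorEquality
open import Function.Bundles using (_⇔_)
open import Level using (Level; _⊔_) renaming (suc to lsuc)
open import Relation.Binary.PropositionalEquality.Core using (_≢_)
open import Relation.Nullary.Negation.Core using (¬_)

-- The textbook notion of a field. No decidability of _≈_ and no apartness
-- relation is assumed.
record Field (c ℓ : Level) : Set (lsuc (c ⊔ ℓ)) where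
  field
    commutativeRing : CommutativeRing c ℓ

  open CommutativeRing commutativeRing public

  field
    1≉0           : ¬ (1# ≈ 0#)
    ≉0⇒invertible : ∀ x → ¬ (x ≈ 0#) → Algebra.Definitions.Invertible _≈_ 1# _*_ x

module _ {c ℓ : Level} (K : Field c ℓ) where

  private
    module K where
      open Field K public
      open Algebra.Definitions.RawSemiring (Semiring.rawSemiring semiring) public
        using (sum) renaming (_×_ to _·_)

  HasCharacteristic : ℕ → Set ℓ
  HasCharacteristic p = ∀ m → (m K.· K.1# K.≈ K.0#) ⇔ (p ∣ m)

  -- In characteristic p the prime subfield is { 0 , 1 , … , (p-1)·1 }.
  InPrimeSubfield : ℕ → K.Carrier → Set ℓ
  InPrimeSubfield p x = ∃ λ (m : Fin p) → x K.≈ toℕ m K.· K.1#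

  InPrimeSubfieldˣ : ℕ → K.Carrier → Set ℓ
  InPrimeSubfieldˣ p x = InPrimeSubfield p x × ¬ (x K.≈ K.0#)

  -- Polynomials of degree at most 1, as (constant coefficient , coefficient of s).
  LinearPoly : Set c
  LinearPoly = Vector K.Carrier 2

  s+_ : K.Carrier → LinearPoly
  s+ b = b ∷ K.1# ∷ []

  -- inj₁ (i , j) ↦ s - xᵢ + Λᵢ + a j,   inj₂ (i , j) ↦ s - xᵢ + a j
  linearPolys : ∀ {n} (Λ : Vector K.Carrier n) (a : K.Carrier) (x : Vector K.Carrier n) (p : ℕ) →
                (Fin n × Fin p) ⊎ (Fin n × Fin p) → LinearPoly
  linearPolys Λ a x p (inj₁ (i , j)) = s+ (K.- x i K.+ Λ i K.+ toℕ j K.· a)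
  linearPolys Λ a x p (inj₂ (i , j)) = s+ (K.- x i K.+ toℕ j K.· a)

  PairwiseDistinct : {I : Set} → (I → LinearPoly) → Set ℓ
  PairwiseDistinct f = ∀ k k′ → k ≢ k′ → ¬ (f k ≋ f k′)
    where open VectorEquality K.setoid using (_≋_)

  -- K[[ε]]: the value at m is the coefficient of ε ^ m.
  PowerSeries : Set c
  PowerSeries = ℕ → K.Carrier

  const : K.Carrier → PowerSeries
  const b zero    = b
  const b (suc _) = K.0#

  ε : PowerSeries
  ε (suc zero) = K.1#
  ε _          = K.0#

  powerSeriesRawRing : RawRing c ℓ
  powerSeriesRawRing = record
    { Carrier = PowerSeries
    ; _≈_     = λ f g → ∀ m → f m K.≈ g m
    ; _+_     = λ f g m → f m K.+ g m
    ; _*_     = λ f g m → K.sum λ (k : Fin (suc m)) → f (toℕ k) K.* g (m ∸ toℕ k)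
    ; -_      = λ f m → K.- f m
    ; 0#      = const K.0#
    ; 1#      = const K.1#
    }

  private
    module P where
      open RawRing powerSeriesRawRing public
      open Algebra.Definitions.RawSemiring rawSemiring public using (_^_; product)

      infixl 6 _-_
      _-_ : PowerSeries → PowerSeries → PowerSeries
      f - g = f + (- g)

  -- K((ε)) as the localisation of K[[ε]] at ε: (ε^- k · f) stands for ε ^ (- k) f.
  record LaurentSeries : Set c where
    constructor ε^-_·_
    field
      pole   : ℕ
      series : PowerSeries

  laurentRawRing : RawRing c ℓ
  laurentRawRing = record
    { Carrier = LaurentSeries
    ; _≈_     = λ { (ε^- k · f) (ε^- m · g) → ε P.^ m P.* f P.≈ ε P.^ k P.* g }
    ; _+_     = λ { (ε^- k · f) (ε^- m · g) → ε^- (k ℕ.+ m) · (ε P.^ m P.* f P.+ ε P.^ k P.* g) }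
    ; _*_     = λ { (ε^- k · f) (ε^- m · g) → ε^- (k ℕ.+ m) · (f P.* g) }
    ; -_      = λ { (ε^- k · f) → ε^- k · (P.- f) }
    ; 0#      = ε^- 0 · P.0#
    ; 1#      = ε^- 0 · P.1#
    }

  private
    module L where
      open RawRing laurentRawRing public
      open Algebra.Definitions.RawSemiring rawSemiring public using (product)
      open Algebra.Definitions _≈_ public using (Invertible)

      infixl 6 _-_
      _-_ : LaurentSeries → LaurentSeries → LaurentSeries
      f - g = f + (- g)

  fromPowerSeries : PowerSeries → LaurentSeries
  fromPowerSeries f = ε^- 0 · f

  constᴸ : K.Carrier → LaurentSeries
  constᴸ b = fromPowerSeries (const b)

  ε⁻¹ : LaurentSeries
  ε⁻¹ = ε^- 1 · P.1#

  IsO : ℕ → LaurentSeries → Set (c ⊔ ℓ)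
  IsO N z = ∃ λ (g : PowerSeries) → z L.≈ fromPowerSeries (ε P.^ N P.* g)

  -- K((ε)) has no total division, so a quotient takes an inverse of its denominator.
  quotient : (z w : LaurentSeries) → L.Invertible L.1# L._*_ w → LaurentSeries
  quotient z w w⁻¹ = z L.* proj₁ w⁻¹

  -- The point s + a j.
  shift : K.Carrier → PowerSeries → ℕ → LaurentSeries
  shift a s j = fromPowerSeries s L.+ constᴸ (j K.· a)

  module _ {n : ℕ} (Λ : Vector K.Carrier n) (a : K.Carrier) where

    record IsBranch (p : ℕ) (x : Vector K.Carrier n) (i : Fin n) (s : PowerSeries) : Set ℓ where
      field
        initial  : s 0 K.≈ x i K.- Λ i
        equation :
          (P.product λ (l : Fin n) → P.product λ (j : Fin p) →
             s P.- const (x l) P.+ const (Λ l) P.+ const (toℕ j K.· a))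
          P.≈
          ε P.^ p P.*
          (P.product λ (l : Fin n) → P.product λ (j : Fin p) →
             s P.- const (x l) P.+ const (toℕ j K.· a))

    numerator denominator : LaurentSeries → Vector K.Carrier n → Fin n → LaurentSeries
    numerator   s x l = s L.- constᴸ (x l) L.+ constᴸ (Λ l)
    denominator s x l = s L.- constᴸ (x l) L.+ constᴸ a

    ΦDefinedAt : LaurentSeries → Vector K.Carrier n → Set (c ⊔ ℓ)
    ΦDefinedAt s x = ∀ l → L.Invertible L.1# L._*_ (denominator s x l)

    Φ : (s : LaurentSeries) (x : Vector K.Carrier n) → ΦDefinedAt s x → LaurentSeries
    Φ s x inv = ε⁻¹ L.* L.product λ l → quotient (numerator s x l) (denominator s x l) (inv l)

    -- ∏_{j<d} Φ(s + a j , x)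
    Φ-product : (d : ℕ) (s : PowerSeries) (x : Vector K.Carrier n) →
                (∀ (j : Fin d) → ΦDefinedAt (shift a s (toℕ j)) x) → LaurentSeries
    Φ-product d s x inv = L.product λ (j : Fin d) → Φ (shift a s (toℕ j)) x (inv j)

{-# OPTIONS --safe #-}

-- At ε = 0 the branch s = sᵢ equals xᵢ - Λᵢ, so by pairwise distinctness every factor
-- s - xₗ + Λₗ + a j with (l , j) ≠ (i , 0) and every factor s - xₗ + a j has a nonzero
-- constant term and is a unit of K[[ε]].  The equation of the branch therefore says
-- that ε ^ p divides the remaining factor s - xᵢ + Λᵢ, which occurs in the numerator of
-- Φ(s , x).  The d prefactors ε⁻¹ lower the order to p - d.
module Submission where

open import Defs
open import Algebra.Bundles using (CommutativeMonoid; CommutativeRing; RawRing; Semiring)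
import Algebra.Definitions
import Algebra.Definitions.RawMonoid
import Algebra.Definitions.RawSemiring
import Algebra.Properties.AbelianGroup
import Algebra.Properties.CommutativeMagma.Divisibility
import Algebra.Properties.CommutativeMonoid.Sum
import Algebra.Properties.CommutativeSemigroup
import Algebra.Properties.CommutativeSemigroup.Divisibility
import Algebra.Properties.Monoid.Divisibility
import Algebra.Properties.Ring
import Algebra.Properties.Semiring.Exp
import Algebra.Properties.Semiring.Sum
open import Data.Fin.Base using (Fin; zero; suc; toℕ; inject≤; punchIn)
open import Data.Fin.Properties using (punchInᵢ≢i; toℕ≤pred[n]; toℕ-inject≤)
open import Data.Nat.Base as ℕ using (ℕ; zero; suc; _≤_; _<_; _∸_; z≤n; s≤s)
import Data.Nat.Properties as ℕ
open import Data.Product.Base using (Σ; _×_; _,_)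
open import Data.Product.Properties using (,-injectiveˡ; ,-injectiveʳ)
open import Data.Sum.Base using (_⊎_; inj₁; inj₂)
open import Data.Sum.Properties using (inj₁-injective)
open import Data.Vec.Functional using (Vector; removeAt)
open import Function.Base using (_∘_)
open import Level using (Level)
open import Relation.Binary.PropositionalEquality as ≡ using (_≡_; _≢_)
import Relation.Binary.Reasoning.Setoid
open import Relation.Nullary.Negation.Core using (¬_)

-- Divisibility and units in a commutative monoid.

module _ {c ℓ : Level} (M : CommutativeMonoid c ℓ) where

  open CommutativeMonoid M
    renaming (_∙_ to _*_; ε to 1#; ∙-congˡ to *-congˡ; ∙-congʳ to *-congʳ)
  open Algebra.Properties.Monoid.Divisibility monoid
    using (_∣_; _,_; ∣ʳ-refl; ∣ʳ-trans; ∣ʳ-respʳ-≈; x∣ʳyx)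
  open Algebra.Properties.CommutativeSemigroup.Divisibility commutativeSemigroup
    using (x∣xy; x∣y⇒zx∣zy) renaming (∙-cong-∣ to *-cong-∣)
  open Algebra.Properties.CommutativeMonoid.Sum M
    using () renaming (sum to product; sum-remove to product-remove)
  open Algebra.Definitions.RawMonoid rawMonoid using () renaming (_×_ to _^ʳ_)

  product∣1 : ∀ {n} (t : Vector Carrier n) → (∀ i → t i ∣ 1#) → product t ∣ 1#
  product∣1 {zero}  t t∣1 = ∣ʳ-refl
  product∣1 {suc n} t t∣1 =
    ∣ʳ-respʳ-≈ (identityˡ 1#) (*-cong-∣ (t∣1 zero) (product∣1 (t ∘ suc) (t∣1 ∘ suc)))

  factor∣product : ∀ {n} (t : Vector Carrier n) i → t i ∣ product t
  factor∣product t zero    = x∣xy (t zero) _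
  factor∣product t (suc i) = ∣ʳ-trans (factor∣product (t ∘ suc) i) (x∣ʳyx _ (t zero))

  -- If `v * u ≈ 1#` then `v * (y * u) ≈ y`, so `y * u` itself divides `y`.
  ∣-cancelʳ-unit : ∀ {x y u} → u ∣ 1# → x ∣ y * u → x ∣ y
  ∣-cancelʳ-unit {y = y} (v , vu≈1) x∣yu = ∣ʳ-trans x∣yu
    (v , trans (*-congˡ (comm y _)) (trans (sym (assoc v _ y)) (trans (*-congʳ vu≈1) (identityˡ y))))

  -- Taking `t i` out of the product leaves a product of units, which is cancelled.
  ∣product⇒∣factor : ∀ {n} (t : Vector Carrier n) i → (∀ k → k ≢ i → t k ∣ 1#) →
                     ∀ {x} → x ∣ product t → x ∣ t i
  ∣product⇒∣factor {suc n} t i others x∣t = ∣-cancelʳ-unit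
    (product∣1 (removeAt t i) λ k → others (punchIn i k) (punchInᵢ≢i i k))
    (∣ʳ-respʳ-≈ (product-remove t) x∣t)

  ^-mono-∣ : ∀ x {m n} → m ≤ n → (m ^ʳ x) ∣ (n ^ʳ x)
  ^-mono-∣ x {n = n} z≤n = n ^ʳ x , identityʳ _
  ^-mono-∣ x (s≤s m≤n)   = x∣y⇒zx∣zy x (^-mono-∣ x m≤n)

-- The commutative ring of formal power series and its units.

module PowerSeriesRing {c ℓ : Level} (F : Field c ℓ) where

  private
    module K where
      open Field F public
      open Algebra.Properties.Semiring.Sum semiring public
        using (sum; sum-cong-≋; sum-replicate-zero; ∑-distrib-+; *-distribˡ-sum)
      open Algebra.Properties.Ring ring public using (-‿distribʳ-*)
      open Relation.Binary.Reasoning.Setoid setoid public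

    open RawRing (powerSeriesRawRing F)

  -- Since `f = f 0 + ε * tail f`, coefficient `suc m` of `f * g` unfolds definitionally to
  -- `f 0 * g (suc m)` plus coefficient `m` of `tail f * g`. The inductions below rest on this.
  tail : PowerSeries F → PowerSeries F
  tail f m = f (suc m)

  term : PowerSeries F → PowerSeries F → (m : ℕ) → Vector K.Carrier (suc m)
  term f g m k = f (toℕ k) K.* g (m ∸ toℕ k)

  *-cong : ∀ {f g h k} → f ≈ g → h ≈ k → f * h ≈ g * k
  *-cong {f} {g} {h} {k} f≈g h≈k m = K.sum-cong-≋ {suc m} {term f h m} {term g k m}
    λ j → K.*-cong (f≈g (toℕ j)) (h≈k (m ∸ toℕ j))

  -- Splits off the last summand of the convolution, where unfolding splits off the first. Swapping
  -- the factors exchanges these two splittings, whence `*-comm`.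
  *-suc : ∀ f g m → (f * g) (suc m) K.≈ (f * tail g) m K.+ f (suc m) K.* g 0
  *-suc f g zero = K.begin
    f 0 K.* g 1 K.+ (f 1 K.* g 0 K.+ K.0#)  K.≈⟨ K.+-congˡ (K.+-comm _ _) ⟩
    f 0 K.* g 1 K.+ (K.0# K.+ f 1 K.* g 0)  K.≈⟨ K.+-assoc _ _ _ ⟨
    f 0 K.* g 1 K.+ K.0# K.+ f 1 K.* g 0    K.∎
  *-suc f g (suc m) = K.begin
    f 0 K.* g (suc (suc m)) K.+ (tail f * g) (suc m)
      K.≈⟨ K.+-congˡ (*-suc (tail f) g m) ⟩
    f 0 K.* g (suc (suc m)) K.+ ((tail f * tail g) m K.+ f (suc (suc m)) K.* g 0)
      K.≈⟨ K.+-assoc _ _ _ ⟨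
    (f * tail g) (suc m) K.+ f (suc (suc m)) K.* g 0  K.∎

  *-comm : ∀ f g → f * g ≈ g * f
  *-comm f g zero    = K.+-congʳ (K.*-comm _ _)
  *-comm f g (suc m) = K.begin
    f 0 K.* g (suc m) K.+ (tail f * g) m  K.≈⟨ K.+-cong (K.*-comm _ _) (*-comm (tail f) g m) ⟩
    g (suc m) K.* f 0 K.+ (g * tail f) m  K.≈⟨ K.+-comm _ _ ⟩
    (g * tail f) m K.+ g (suc m) K.* f 0  K.≈⟨ *-suc g f m ⟨
    (g * f) (suc m)                       K.∎

  *-distribʳ-+ : ∀ f g h → (g + h) * f ≈ g * f + h * f
  *-distribʳ-+ f g h m = K.trans
    (K.sum-cong-≋ {suc m} {term (g + h) f m} {λ k → term g f m k K.+ term h f m k}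
      λ k → K.distribʳ (f (m ∸ toℕ k)) (g (toℕ k)) (h (toℕ k)))
    (K.∑-distrib-+ (term g f m) (term h f m))

  *-scaleˡ : ∀ b f g m → ((λ k → b K.* f k) * g) m K.≈ b K.* (f * g) m
  *-scaleˡ b f g m = K.trans
    (K.sum-cong-≋ {suc m} {term (λ k → b K.* f k) g m} {λ k → b K.* term f g m k}
      λ k → K.*-assoc b (f (toℕ k)) (g (m ∸ toℕ k)))
    (K.sym (K.*-distribˡ-sum b (term f g m)))

  *-assoc : ∀ f g h → (f * g) * h ≈ f * (g * h)
  *-assoc f g h zero = K.+-congʳ (K.begin
    (f 0 K.* g 0 K.+ K.0#) K.* h 0  K.≈⟨ K.*-congʳ (K.+-identityʳ _) ⟩
    f 0 K.* g 0 K.* h 0             K.≈⟨ K.*-assoc _ _ _ ⟩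
    f 0 K.* (g 0 K.* h 0)           K.≈⟨ K.*-congˡ (K.+-identityʳ _) ⟨
    f 0 K.* (g 0 K.* h 0 K.+ K.0#)  K.∎)
  *-assoc f g h (suc m) = K.begin
    (f * g) 0 K.* h (suc m) K.+ (tail (f * g) * h) m
      K.≈⟨ K.+-cong
             (K.trans (K.*-congʳ (K.+-identityʳ _)) (K.*-assoc _ _ _))
             -- By definition `tail (f * g)` is the sum of `f 0` times `tail g` and `tail f * g`, so
             -- distributivity applies and the induction hypothesis handles the second summand.
             (K.trans (*-distribʳ-+ h (λ k → f 0 K.* tail g k) (tail f * g) m)
                      (K.+-cong (*-scaleˡ (f 0) (tail g) h m) (*-assoc (tail f) g h m))) ⟩
    f 0 K.* (g 0 K.* h (suc m)) K.+ (f 0 K.* (tail g * h) m K.+ (tail f * (g * h)) m)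
      K.≈⟨ K.+-assoc _ _ _ ⟨
    f 0 K.* (g 0 K.* h (suc m)) K.+ f 0 K.* (tail g * h) m K.+ (tail f * (g * h)) m
      K.≈⟨ K.+-congʳ (K.distribˡ _ _ _) ⟨
    (f * (g * h)) (suc m)  K.∎

  *-identityˡ : ∀ f → 1# * f ≈ f
  *-identityˡ f zero    = K.trans (K.+-identityʳ _) (K.*-identityˡ _)
  *-identityˡ f (suc m) = K.trans
    (K.+-cong (K.*-identityˡ _)
      (K.trans
        (K.sum-cong-≋ {suc m} {term (tail 1#) f m} {λ _ → K.0#} λ k → K.zeroˡ (f (m ∸ toℕ k)))
        (K.sum-replicate-zero (suc m))))
    (K.+-identityʳ _)

  -- `0#` is `const K.0#`, defined by cases, so it does not reduce at a variable index.
  0#-const : ∀ m → 0# m K.≈ K.0#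
  0#-const zero    = K.refl
  0#-const (suc m) = K.refl

  commutativeRing : CommutativeRing c ℓ
  commutativeRing = record
    { RawRing (powerSeriesRawRing F)
    ; isCommutativeRing = record
      { isRing = record
        { +-isAbelianGroup = record
          { isGroup = record
            { isMonoid = record
              { isSemigroup = record
                { isMagma = record
                  { isEquivalence = record
                    { refl  = λ _ → K.refl
                    ; sym   = λ f≈g m → K.sym (f≈g m)
                    ; trans = λ f≈g g≈h m → K.trans (f≈g m) (g≈h m)
                    }
                  ; ∙-cong = λ f≈g h≈k m → K.+-cong (f≈g m) (h≈k m)
                  }
                ; assoc = λ f g h m → K.+-assoc _ _ _
                }
              ; identity = (λ f m → K.trans (K.+-congʳ (0#-const m)) (K.+-identityˡ _))
                         , (λ f m → K.trans (K.+-congˡ (0#-const m)) (K.+-identityʳ _))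
              }
            ; inverse = (λ f m → K.trans (K.-‿inverseˡ _) (K.sym (0#-const m)))
                      , (λ f m → K.trans (K.-‿inverseʳ _) (K.sym (0#-const m)))
            ; ⁻¹-cong = λ f≈g m → K.-‿cong (f≈g m)
            }
          ; comm = λ f g m → K.+-comm _ _
          }
        ; *-cong = *-cong
        ; *-assoc = *-assoc
        ; *-identity = *-identityˡ
                     , λ f m → K.trans (*-comm f 1# m) (*-identityˡ f m)
        ; distrib = (λ f g h m → K.trans (*-comm f (g + h) m)
                      (K.trans (*-distribʳ-+ f g h m)
                        (K.+-cong (*-comm g f m) (*-comm h f m))))
                  , *-distribʳ-+
        }
      ; *-comm = *-comm
      }
    }

  -- history u f m k, for k ≤ m, is the coefficient of ε ^ (m - k) in the inverse of f,
  -- where u inverts f 0; carrying all earlier coefficients makes the recursion structural.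
  history : K.Carrier → PowerSeries F → ℕ → ℕ → K.Carrier
  history u f zero    _       = u
  history u f (suc m) zero    =
    K.- (u K.* K.sum λ (k : Fin (suc m)) → f (suc (toℕ k)) K.* history u f m (toℕ k))
  history u f (suc m) (suc k) = history u f m k

  inverse : K.Carrier → PowerSeries F → PowerSeries F
  inverse u f m = history u f m 0

  history-inverse : ∀ u f {m k} → k ≤ m → history u f m k ≡ inverse u f (m ∸ k)
  history-inverse u f z≤n       = ≡.refl
  history-inverse u f (s≤s k≤m) = history-inverse u f k≤m

  -- Coefficient `suc m` of the product is `f 0` times the new coefficient of the inverse plus a sum
  -- `rest` over the old ones. The recursion sets the new coefficient to `- (u * earlier)`, and
  -- `earlier` is `rest` read through `history`.
  *-inverse : ∀ u f → f 0 K.* u K.≈ K.1# → f * inverse u f ≈ 1#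
  *-inverse u f f₀u≈1 zero    = K.trans (K.+-identityʳ _) f₀u≈1
  *-inverse u f f₀u≈1 (suc m) = K.begin
    f 0 K.* (K.- (u K.* earlier)) K.+ rest  K.≈⟨ K.+-congʳ (K.-‿distribʳ-* _ _) ⟨
    K.- (f 0 K.* (u K.* earlier)) K.+ rest  K.≈⟨ K.+-congʳ (K.-‿cong (K.*-assoc _ _ _)) ⟨
    K.- (f 0 K.* u K.* earlier) K.+ rest    K.≈⟨ K.+-congʳ (K.-‿cong (K.*-cong f₀u≈1 earlier≈rest)) ⟩
    K.- (K.1# K.* rest) K.+ rest            K.≈⟨ K.+-congʳ (K.-‿cong (K.*-identityˡ _)) ⟩
    K.- rest K.+ rest                       K.≈⟨ K.-‿inverseˡ _ ⟩
    K.0#                                    K.∎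
    where
    earlierTerm : Vector K.Carrier (suc m)
    earlierTerm k = f (suc (toℕ k)) K.* history u f m (toℕ k)

    earlier rest : K.Carrier
    earlier = K.sum earlierTerm
    rest    = (tail f * inverse u f) m

    earlier≈rest : earlier K.≈ rest
    earlier≈rest = K.sum-cong-≋ {suc m} {earlierTerm} {term (tail f) (inverse u f) m} λ k →
      K.*-congˡ {f (suc (toℕ k))} (K.reflexive (history-inverse u f (toℕ≤pred[n] k)))

  open Algebra.Properties.CommutativeMagma.Divisibility
    (CommutativeRing.*-commutativeMagma commutativeRing) using (_∣_; xy≈z⇒x∣z)

  constantTerm≉0⇒∣1 : ∀ f → ¬ (f 0 K.≈ K.0#) → f ∣ 1#
  constantTerm≉0⇒∣1 f f₀≉0 with K.≉0⇒invertible (f 0) f₀≉0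
  ... | u , _ , f₀u≈1 = xy≈z⇒x∣z f (inverse u f) (*-inverse u f f₀u≈1)

-- Laurent series as fractions with a power of `ε` as denominator.

module LaurentSeriesProperties {c ℓ : Level} (F : Field c ℓ) where

  open PowerSeriesRing F using (commutativeRing)

  private
    module P where
      open CommutativeRing commutativeRing public
      open Algebra.Properties.Semiring.Exp semiring public
        using (_^_; ^-homo-*)
      open Algebra.Definitions.RawSemiring (Semiring.rawSemiring semiring) public using (product)
      open Algebra.Properties.Monoid.Divisibility *-monoid public
        using (_∣_; _,_; ∣ʳ-trans)
      open Relation.Binary.Reasoning.Setoid setoid public

    module L where
      open RawRing (laurentRawRing F) public
      open Algebra.Definitions.RawSemiring rawSemiring public using (product)
      open Algebra.Definitions _≈_ public using (Invertible)

  open LaurentSeries using (pole; series)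

  -- `pole` is the exponent in the chosen representation, not the order of the series, so
  -- multiplication adds it by definition.
  pole-product : ∀ {n k} (t : Vector (LaurentSeries F) n) → (∀ i → pole (t i) ≡ k) →
                 pole (L.product t) ≡ n ℕ.* k
  pole-product {zero}  t t-pole = ≡.refl
  pole-product {suc n} t t-pole =
    ≡.cong₂ ℕ._+_ (t-pole zero) (pole-product (t ∘ suc) (t-pole ∘ suc))

  series-product : ∀ {n} (t : Vector (LaurentSeries F) n) →
                   series (L.product t) ≡ P.product (series ∘ t)
  series-product {zero}  t = ≡.refl
  series-product {suc n} t = ≡.cong (series (t zero) P.*_) (series-product (t ∘ suc))

  -- Bringing both summands to the common denominator multiplies each by `ε ^ 0`, which is `1#`.
  fromPowerSeries-+ : ∀ f g → series (fromPowerSeries F f L.+ fromPowerSeries F g) P.≈ f P.+ g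
  fromPowerSeries-+ f g = P.+-cong (P.*-identityˡ f) (P.*-identityˡ g)

  fromPowerSeries-invertible : ∀ {f} → f P.∣ P.1# → L.Invertible L.1# L._*_ (fromPowerSeries F f)
  fromPowerSeries-invertible {f} (g P., gf≈1) =
    fromPowerSeries F g , P.*-congˡ {P.1#} gf≈1 , P.*-congˡ {P.1#} (P.trans (P.*-comm f g) gf≈1)

  -- Of the powers of `ε` dividing the series, `pole z` cancel the denominator and `N` remain; the
  -- cofactor `q` is the witness.
  ε^∣series⇒IsO : ∀ {m N} z → pole z ℕ.+ N ≤ m → ε F P.^ m P.∣ series z → IsO F N z
  ε^∣series⇒IsO {m} {N} z pole+N≤m ε^m∣z
    with P.∣ʳ-trans (^-mono-∣ P.*-commutativeMonoid (ε F) pole+N≤m) ε^m∣z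
  ... | q P., q*ε^≈z = q , (P.begin
    P.1# P.* series z                           P.≈⟨ P.*-identityˡ _ ⟩
    series z                                    P.≈⟨ q*ε^≈z ⟨
    q P.* ε F P.^ (pole z ℕ.+ N)                P.≈⟨ P.*-comm q _ ⟩
    ε F P.^ (pole z ℕ.+ N) P.* q                P.≈⟨ P.*-congʳ (P.^-homo-* (ε F) (pole z) N) ⟩
    ε F P.^ pole z P.* ε F P.^ N P.* q          P.≈⟨ P.*-assoc (ε F P.^ pole z) (ε F P.^ N) q ⟩
    ε F P.^ pole z P.* (ε F P.^ N P.* q)        P.∎)

-- Order of vanishing along one branch.

-- The p of the statement is suc q here, so that Fin p has the element zero.
module Branch {c ℓ : Level} (F : Field c ℓ) {n q : ℕ} (Λ : Vector (Field.Carrier F) n)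
  (a : Field.Carrier F) (x : Vector (Field.Carrier F) n)
  (distinct : PairwiseDistinct F (linearPolys F Λ a x (suc q)))
  (i : Fin n) (s : PowerSeries F) (branch : IsBranch F Λ a (suc q) x i s)
  where

  open PowerSeriesRing F using (commutativeRing; constantTerm≉0⇒∣1)
  open LaurentSeriesProperties F
  open LaurentSeries using (pole; series)
  open IsBranch branch

  private
    module K where
      open Field F public
      open Algebra.Definitions.RawSemiring (Semiring.rawSemiring semiring) public
        using () renaming (_×_ to _·_)
      open Algebra.Properties.AbelianGroup +-abelianGroup public
        using () renaming (inverseʳ-unique to +-inverseʳ-unique; ⁻¹-∙-comm to -‿+-comm;
                           ⁻¹-involutive to -‿involutive)
      open Algebra.Properties.CommutativeSemigroup +-commutativeSemigroup public
        using () renaming (xy∙z≈xz∙y to x+y+z≈x+z+y)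
      open Relation.Binary.Reasoning.Setoid setoid public

    module P where
      open CommutativeRing commutativeRing public
      open Algebra.Definitions.RawSemiring (Semiring.rawSemiring semiring) public
        using (_^_; product)
      open Algebra.Properties.Monoid.Divisibility *-monoid public
        using (_∣_; ∣ʳ-trans; ∣ʳ-respˡ-≈; ∣ʳ-respʳ-≈; ∣ʳ-reflexive; x∣ʳyx)
      open Algebra.Properties.CommutativeSemigroup.Divisibility *-commutativeSemigroup public
        using (x∣xy)
      open Algebra.Properties.CommutativeSemigroup +-commutativeSemigroup public
        using () renaming (xy∙z≈xz∙y to x+y+z≈x+z+y)

    module L = RawRing (laurentRawRing F)

  factor : Fin n → Fin (suc q) → PowerSeries F
  factor l j = s P.- const F (x l) P.+ const F (Λ l) P.+ const F (toℕ j K.· a)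

  -- If `f 0` vanished, `b` would equal `- s 0`, that is `- x i + Λ i`. The polynomial indexed by
  -- `k` would then coincide with the one indexed by `inj₁ (i , zero)`, against distinctness.
  unit-if-other-root : ∀ {b} f → f 0 K.≈ s 0 K.+ b →
                       (k : (Fin n × Fin (suc q)) ⊎ (Fin n × Fin (suc q))) →
                       linearPolys F Λ a x (suc q) k zero K.≈ b → k ≢ inj₁ (i , zero) →
                       f P.∣ P.1#
  unit-if-other-root {b} f f₀≈s₀+b k k≈b k≢i0 = constantTerm≉0⇒∣1 f λ f₀≈0 →
    distinct k (inj₁ (i , zero)) k≢i0 λ where
      zero       → K.trans k≈b (root-unique (K.trans (K.sym f₀≈s₀+b) f₀≈0))
      (suc zero) → slope k
    where
    -- The final `K.0#` is what `toℕ zero · a` reduces to.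
    root-unique : s 0 K.+ b K.≈ K.0# → b K.≈ K.- x i K.+ Λ i K.+ K.0#
    root-unique s₀+b≈0 = K.begin
      b                          K.≈⟨ K.+-inverseʳ-unique _ _ s₀+b≈0 ⟩
      K.- s 0                    K.≈⟨ K.-‿cong initial ⟩
      K.- (x i K.+ K.- Λ i)      K.≈⟨ K.-‿+-comm _ _ ⟨
      K.- x i K.+ K.- (K.- Λ i)  K.≈⟨ K.+-congˡ (K.-‿involutive _) ⟩
      K.- x i K.+ Λ i            K.≈⟨ K.+-identityʳ _ ⟨
      K.- x i K.+ Λ i K.+ K.0#   K.∎

    slope : ∀ k → linearPolys F Λ a x (suc q) k (suc zero) K.≈ K.1#
    slope (inj₁ _) = K.refl
    slope (inj₂ _) = K.refl

  factor∣1 : ∀ l j → (l , j) ≢ (i , zero) → factor l j P.∣ P.1#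
  factor∣1 l j lj≢i0 = unit-if-other-root (factor l j)
    (K.trans (K.+-congʳ (K.+-assoc _ _ _)) (K.+-assoc _ _ _))
    (inj₁ (l , j)) K.refl (lj≢i0 ∘ inj₁-injective)

  -- Units are cancelled twice in the left side of the branch equation: first the inner products
  -- with `l ≢ i`, then the factors with `j ≢ zero`.
  ε^p∣factor : ε F P.^ suc q P.∣ factor i zero
  ε^p∣factor =
    ∣product⇒∣factor P.*-commutativeMonoid (factor i) zero
      (λ j j≢0 → factor∣1 i j (j≢0 ∘ ,-injectiveʳ))
      (∣product⇒∣factor P.*-commutativeMonoid (λ l → P.product (factor l)) i
        (λ l l≢i → product∣1 P.*-commutativeMonoid (factor l)
          λ j → factor∣1 l j (l≢i ∘ ,-injectiveˡ))
        (P.∣ʳ-respʳ-≈ (P.sym equation) (P.x∣xy _ _)))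

  series-shift : ∀ j y z → series ((shift F a s j L.+ (L.- constᴸ F y)) L.+ constᴸ F z)
                 P.≈ s P.+ const F (j K.· a) P.- const F y P.+ const F z
  series-shift j y z = P.trans (fromPowerSeries-+ _ _) (P.+-congʳ
    (P.trans (fromPowerSeries-+ _ _) (P.+-congʳ (fromPowerSeries-+ _ _))))

  module _ {d : ℕ} (d≤q : d ≤ q) where

    -- The denominator at `s + a j` is `s - x l + a (j + 1)`, a polynomial of the second family. Its
    -- index `j + 1` is at most `d`, hence at most `q`, so it stays below `p`.
    denominator∣1 : ∀ (j : Fin d) l → series (denominator F Λ a (shift F a s (toℕ j)) x l) P.∣ P.1#
    denominator∣1 j l = unit-if-other-root _
      (K.begin
        -- The last argument `0` selects the constant coefficient.
        _                                                K.≈⟨ series-shift (toℕ j) (x l) a 0 ⟩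
        s 0 K.+ toℕ j K.· a K.+ K.- x l K.+ a            K.≈⟨ K.+-congʳ (K.x+y+z≈x+z+y _ _ _) ⟩
        s 0 K.+ K.- x l K.+ toℕ j K.· a K.+ a            K.≈⟨ K.+-assoc _ _ _ ⟩
        s 0 K.+ K.- x l K.+ (toℕ j K.· a K.+ a)          K.≈⟨ K.+-assoc _ _ _ ⟩
        s 0 K.+ (K.- x l K.+ (toℕ j K.· a K.+ a))        K.∎)
      (inj₂ (l , suc (inject≤ j d≤q)))
      (K.+-congˡ (K.trans
        (K.reflexive (≡.cong (λ m → suc m K.· a) (toℕ-inject≤ j d≤q)))
        (K.+-comm _ _)))
      (λ ())

    defined : ∀ (j : Fin d) → ΦDefinedAt F Λ a (shift F a s (toℕ j)) x
    defined j l = fromPowerSeries-invertible (denominator∣1 j l)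

    quotients : Fin d → Vector (LaurentSeries F) n
    quotients j l =
      quotient F (numerator F Λ a sⱼ x l) (denominator F Λ a sⱼ x l) (defined j l)
      where
      sⱼ : LaurentSeries F
      sⱼ = shift F a s (toℕ j)

    -- Each `Φ` contributes only the pole of `ε⁻¹`: the numerators and the inverses chosen in
    -- `defined` are represented with pole 0.
    pole-Φ-product : pole (Φ-product F Λ a d s x defined) ≡ d
    pole-Φ-product = ≡.trans
      (pole-product {d} {1} (λ j → Φ F Λ a (shift F a s (toℕ j)) x (defined j)) λ j → ≡.cong suc
        (≡.trans (pole-product {n} {0} (quotients j) λ l → ≡.refl) (ℕ.*-zeroʳ n)))
      (ℕ.*-identityʳ d)

  -- The vanishing factor is the numerator with `j = 0` and `l = i`, present because the number of
  -- factors `suc d` is positive. Divisibility is passed up from it to its quotient, to `Φ` at `s`,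
  -- and to the whole product.
  ε^p∣Φ-product : ∀ {d} (d<q : suc d ≤ q) →
                  ε F P.^ suc q P.∣ series (Φ-product F Λ a (suc d) s x (defined d<q))
  ε^p∣Φ-product d<q = P.∣ʳ-trans ε^p∣factor
    (P.∣ʳ-respˡ-≈ numerator≈factor
      (P.∣ʳ-trans (P.x∣xy (series (numerator F Λ a (shift F a s 0) x i)) _)
        (P.∣ʳ-trans (factor∣product P.*-commutativeMonoid (series ∘ quotients d<q zero) i)
          (P.∣ʳ-trans (P.∣ʳ-reflexive (P.reflexive (≡.sym (series-product (quotients d<q zero)))))
            -- Here `P.1#` is the series of `ε⁻¹`; the second divisibility adjoins the values of `Φ`
            -- at the later shifts.
            (P.∣ʳ-trans (P.x∣ʳyx _ P.1#) (P.x∣xy _ _))))))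
    where
    numerator≈factor : series (numerator F Λ a (shift F a s 0) x i) P.≈ factor i zero
    numerator≈factor = P.trans (series-shift 0 (x i) (Λ i))
      (P.trans (P.+-congʳ (P.x+y+z≈x+z+y _ _ _)) (P.x+y+z≈x+z+y _ _ _))

  Φ-product-IsO : ∀ {d N} (d<q : suc d ≤ q) → suc d ℕ.+ N ≤ suc q →
                  IsO F N (Φ-product F Λ a (suc d) s x (defined d<q))
  Φ-product-IsO {d} {N} d<q d+N≤p = ε^∣series⇒IsO
    (Φ-product F Λ a (suc d) s x (defined d<q))
    (≡.subst (λ k → k ℕ.+ N ≤ suc q) (≡.sym (pole-Φ-product d<q)) d+N≤p)
    (ε^p∣Φ-product d<q)

lemmaB2 : {c ℓ : Level} (K : Field c ℓ) (p : ℕ) → 2 < p → HasCharacteristic K p →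
    (n : ℕ) → 1 ≤ n →
    (Λ : Vector (Field.Carrier K) n) → (∀ i → InPrimeSubfieldˣ K p (Λ i)) →
    (a : Field.Carrier K) → ¬ InPrimeSubfield K p a →
    (x⁰ : Vector (Field.Carrier K) n) → PairwiseDistinct K (linearPolys K Λ a x⁰ p) →
    (s : Fin n → PowerSeries K) → (∀ i → IsBranch K Λ a p x⁰ i (s i)) →
    (i : Fin n) (d : ℕ) → 1 ≤ d → d ≤ p ∸ 1 →
    Σ (∀ (j : Fin d) → ΦDefinedAt K Λ a (shift K a (s i) (toℕ j)) x⁰) λ inv →
    IsO K (p ∸ d) (Φ-product K Λ a d (s i) x⁰ inv) ×
    IsO K 1 (Φ-product K Λ a d (s i) x⁰ inv)
lemmaB2 K (suc q) _ _ n _ Λ _ a _ x⁰ distinct s branch i (suc d) _ d<q =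
    defined d<q
  -- With `N = p - d` the bound `d + N ≤ p` is an equality; with `N = 1`, on the next line, it
  -- restates `d ≤ p - 1`.
  , Φ-product-IsO d<q (ℕ.≤-reflexive (ℕ.m+[n∸m]≡n (ℕ.m≤n⇒m≤1+n d<q)))
  , Φ-product-IsO d<q (ℕ.≤-trans (ℕ.≤-reflexive (ℕ.+-comm (suc d) 1)) (s≤s d<q))
  where open Branch K Λ a x⁰ distinct i (s i) (branch i)
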